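{- For every integer $n \ge 9$ there exists an $n$-vertex graph $H$ such that $H_3$ is triangle-free, $|E(H_3)| = \left\lfloor \frac{(n-2)^2}{4} \right\rfloor$, and $H_3$ is not isomorphic to $D_3$, where $D$ is the balanced double broom (for distance three) on $n$ vertices.
   Context: All graphs are finite, simple and undirected. For a graph $G$, the $3$-distance graph $G_3$ is the graph on vertex set $V(G)$ in which two vertices are adjacent if and only if their distance in $G$ is exactly $3$. The balanced double broom (for distance three) on $n$ vertices is the tree consisting of two adjacent vertices $x,y$ together with $n-2$ leaves, of which $\lfloor (n-2)/2\rfloor$ are attached to $x$ and $\lceil (n-2)/2\rceil$ are attached to $y$. -}

module Defs where

open import Data.Bool using (Bool; true; false; T)
open import Data.Bool.Properties using (T?)
open import Data.Fin using (Fin; zero; suc; splitAt; _<_)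
open import Data.Fin.Properties using (any?; _≟_; _<?_)
open import Data.List using (List; filter; cartesianProduct; allFin)
open import Data.Nat as ℕ using (ℕ; zero; suc; _+_; _∸_; ⌊_/2⌋; ⌈_/2⌉; NonZero; >-nonZero⁻¹)
open import Data.Nat.Properties using (allUpTo?)
open import Data.Product using (_×_; _,_)
open import Data.Sum using ([_,_]′)
open import Function using (_∘_; const)
open import Function.Bundles using (_↔_; _⇔_; Inverse)
open import Level using (0ℓ)
open import Relation.Binary using (Rel; Symmetric; Irreflexive; Decidable)
open import Relation.Binary.PropositionalEquality using (_≡_; refl)
open import Relation.Nullary using (¬_; ¬?; _×-dec_)
open import Relation.Nullary.Decidable using (map′)
import Relation.Unary as Unary

record Graph (n : ℕ) : Set₁ where
  field
    Adj    : Rel (Fin n) 0ℓ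
    sym    : Symmetric Adj
    irrefl : Irreflexive _≡_ Adj
    adj?   : Decidable Adj

open Graph public using (Adj; adj?)

private
  variable
    m n k : ℕ

data Walk (G : Graph n) : ℕ → Rel (Fin n) 0ℓ where
  []  : ∀ {u} → Walk G 0 u u
  _∷_ : ∀ {k u v w} → Adj G u v → Walk G k v w → Walk G (suc k) u w

-- Vertices in different components are at no distance from each other.
Distance : Graph n → ℕ → Rel (Fin n) 0ℓ
Distance G k u v = Walk G k u v × (∀ {j} → j ℕ.< k → ¬ Walk G j u v)

module _ (G : Graph n) where

  walk-snoc : ∀ {u v w} → Walk G k u v → Adj G v w → Walk G (suc k) u w
  walk-snoc []       e = e ∷ []
  walk-snoc (d ∷ ds) e = d ∷ walk-snoc ds e

  walk-sym : Symmetric (Walk G k)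
  walk-sym []       = []
  walk-sym (e ∷ es) = walk-snoc (walk-sym es) (Graph.sym G e)

  walk? : ∀ k → Decidable (Walk G k)
  walk? zero    u w = map′ (λ { refl → [] }) (λ { [] → refl }) (u ≟ w)
  walk? (suc k) u w =
    map′ (λ { (v , e , es) → e ∷ es }) (λ { (e ∷ es) → _ , e , es })
         (any? λ v → adj? G u v ×-dec walk? k v w)

  distance-sym : Symmetric (Distance G k)
  distance-sym (p , shortest) = walk-sym p , λ j<k → shortest j<k ∘ walk-sym

  distance-irrefl : .{{_ : NonZero k}} → Irreflexive _≡_ (Distance G k)
  distance-irrefl {k = k} refl (_ , shortest) = shortest (>-nonZero⁻¹ k) []

  distance? : ∀ k → Decidable (Distance G k)
  distance? k u v = walk? k u v ×-dec allUpTo? (λ j → ¬? (walk? j u v)) k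

distanceGraph : ∀ k → .{{_ : NonZero k}} → Graph n → Graph n
distanceGraph k G = record
  { Adj    = Distance G k
  ; sym    = distance-sym G
  ; irrefl = distance-irrefl G
  ; adj?   = distance? G k
  }

TriangleFree : Graph n → Set
TriangleFree G = ∀ u v w → Adj G u v → Adj G v w → ¬ Adj G u w

-- Each edge is listed once, with its smaller endpoint first.
IsEdge : (G : Graph n) → Fin n × Fin n → Set
IsEdge G (u , v) = u < v × Adj G u v

isEdge? : (G : Graph n) → Unary.Decidable (IsEdge G)
isEdge? G (u , v) = u <? v ×-dec adj? G u v

edges : Graph n → List (Fin n × Fin n)
edges {n} G = filter (isEdge? G) (cartesianProduct (allFin n) (allFin n))

-- The orders m and n may differ syntactically (as for the balanced double broom
-- below); an isomorphism forces them to be equal.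
infix 4 _≅_
record _≅_ (G : Graph m) (H : Graph n) : Set where
  field
    vertices : Fin m ↔ Fin n
    adjacent : ∀ u v →
      Adj G u v ⇔ Adj H (Inverse.to vertices u) (Inverse.to vertices v)

data Role : Set where
  x y leaf-of-x leaf-of-y : Role

joined : Role → Role → Bool
joined x         y         = true
joined y         x         = true
joined x         leaf-of-x = true
joined leaf-of-x x         = true
joined y         leaf-of-y = true
joined leaf-of-y y         = true
joined _         _         = false

joined-sym : ∀ r s → T (joined r s) → T (joined s r)
joined-sym x         y         t = t
joined-sym y         x         t = t
joined-sym x         leaf-of-x t = t
joined-sym leaf-of-x x         t = t
joined-sym y         leaf-of-y t = t
joined-sym leaf-of-y y         t = t

joined-irrefl : ∀ r → ¬ T (joined r r)
joined-irrefl x         ()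
joined-irrefl y         ()
joined-irrefl leaf-of-x ()
joined-irrefl leaf-of-y ()

role : ∀ a {b} → Fin (2 + (a + b)) → Role
role a zero          = x
role a (suc zero)    = y
role a (suc (suc i)) = [ const leaf-of-x , const leaf-of-y ]′ (splitAt a i)

-- Two adjacent vertices x and y, with a leaves attached to x and b leaves
-- attached to y.
doubleBroom : ∀ a b → Graph (2 + (a + b))
doubleBroom a b = record
  { Adj    = λ u v → T (joined (role a u) (role a v))
  ; sym    = λ {u} {v} → joined-sym (role a u) (role a v)
  ; irrefl = λ { {u} refl → joined-irrefl (role a u) }
  ; adj?   = λ u v → T? (joined (role a u) (role a v))
  }

-- For n ≥ 2 the vertex count equals n, by ⌊n/2⌋+⌈n/2⌉≡n.
balancedDoubleBroom : ∀ n → Graph (2 + (⌊ n ∸ 2 /2⌋ + ⌈ n ∸ 2 /2⌉))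
balancedDoubleBroom n = doubleBroom ⌊ n ∸ 2 /2⌋ ⌈ n ∸ 2 /2⌉

{-# OPTIONS --safe #-}

-- H is the spider with legs of lengths 2, 2, 1 in which the short leg and the
-- end of one long leg receive p and q further, pairwise non-adjacent twins.
-- Twins have the same distances to all other vertices, so H₃ is a blow-up of
-- the 3-distance graph of the spider.  That graph consists of the path
-- arm₂ - tip₁ - leaf - tip₂ - arm₁ and the isolated vertex center.  Counting
-- gives (p + 2) (q + 2) edges, which is ⌊(n - 2)²/4⌋ for balanced p and q.
-- H₃ has one isolated vertex, whereas both centres of the double broom D are
-- isolated in D₃.
module Submission where

open import Defs
open import Data.Fin using (Fin; zero; suc; splitAt)
open import Data.Fin.Patterns
open import Data.Fin.Properties using (_≟_; any?; all?)
open import Data.List using (List; []; _∷_; _++_; filter; length; lookup; map; replicate;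
                             cartesianProduct; allFin)
open import Data.List.Properties using (length-++; length-replicate; filter-++;
                                        filter-all; filter-none; filter-≐; map-tabulate;
                                        tabulate-lookup)
open import Data.List.Membership.Propositional using (_∈_)
open import Data.List.Membership.Propositional.Properties using (∈-++⁺ʳ; ∈-lookup)
open import Data.List.Relation.Unary.All as All using (All; []; _∷_)
open import Data.List.Relation.Unary.All.Properties using (++⁺; replicate⁺)
open import Data.List.Relation.Unary.Any using (index; here; there)
open import Data.List.Relation.Unary.Any.Properties using (lookup-index)
open import Data.Nat using (ℕ; zero; suc; _+_; _*_; _≤_; z≤n; s≤s; _∸_; _^_; _/_;
                            ⌊_/2⌋; ⌈_/2⌉)
import Data.Nat as ℕ
open import Data.Nat.Divisibility using (n∣m*n)
open import Data.Nat.DivMod using (/-congˡ; +-distrib-/-∣ˡ; m*n/n≡m)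
open import Data.Nat.Properties using (+-comm; +-assoc; ⌊n/2⌋+⌈n/2⌉≡n; m+[n∸m]≡n; ≤-trans; m≤m+n)
open import Data.Nat.Tactic.RingSolver using (solve-∀)
open import Data.Product using (Σ-syntax; ∃; _×_; _,_; proj₂)
open import Data.Sum using (_⊎_; inj₁; inj₂; swap; [_,_]′)
open import Function using (_∘_; _⇔_; mk⇔; Equivalence; Inverse)
open import Level using (0ℓ)
open import Relation.Binary.PropositionalEquality
  using (_≡_; _≢_; refl; sym; trans; cong; cong₂; subst; module ≡-Reasoning)
open import Relation.Nullary using (¬_; ¬?; yes; no; contradiction)
open import Relation.Nullary.Decidable using (_×-dec_; _⊎-dec_; _→-dec_; from-yes)
open import Relation.Unary using (Pred; Decidable)

private
  variable
    m n k : ℕ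

-- Counting

module _ {A : Set} {P : Pred A 0ℓ} (P? : Decidable P) where

  count : List A → ℕ
  count = length ∘ filter P?

  count-++ : ∀ xs ys → count (xs ++ ys) ≡ count xs + count ys
  count-++ xs ys = trans (cong length (filter-++ P? xs ys)) (length-++ (filter P? xs))

  count-replicate : ∀ {a} → P a → ∀ r → count (replicate r a) ≡ r
  count-replicate px r =
    trans (cong length (filter-all P? (replicate⁺ r px))) (length-replicate r)

  count-none : ∀ {xs} → All (¬_ ∘ P) xs → count xs ≡ 0
  count-none = cong length ∘ filter-none P?

  count-map : ∀ {B : Set} {Q : Pred B 0ℓ} (Q? : Decidable Q) (f : B → A) →
              (∀ b → P (f b) ⇔ Q b) → ∀ bs → count (map f bs) ≡ length (filter Q? bs)
  count-map Q? f P⇔Q []       = refl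
  count-map Q? f P⇔Q (b ∷ bs) with P? (f b) | Q? b
  ... | yes _ | yes _ = cong suc (count-map Q? f P⇔Q bs)
  ... | no  _ | no  _ = count-map Q? f P⇔Q bs
  ... | yes p | no ¬q = contradiction (Equivalence.to (P⇔Q b) p) ¬q
  ... | no ¬p | yes q = contradiction (Equivalence.from (P⇔Q b) q) ¬p

allFin-suc : ∀ n → allFin (suc n) ≡ zero ∷ map suc (allFin n)
allFin-suc n = cong (zero ∷_) (sym (map-tabulate (λ i → i) suc))

-- The map `f` may be non-injective. Along `suc` this deletes the vertex `zero`; along `lookup vs`
-- it makes a blow-up, where vertices with equal image are non-adjacent by irreflexivity.
pullback : Graph k → (Fin n → Fin k) → Graph n
pullback G f = record
  { Adj    = λ u v → Adj G (f u) (f v)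
  ; sym    = Graph.sym G
  ; irrefl = Graph.irrefl G ∘ cong f
  ; adj?   = λ u v → adj? G (f u) (f v)
  }

module _ (G : Graph (suc n)) where

  private
    G′ : Graph n
    G′ = pullback G suc

  -- Rows and columns are separate lists so that the induction can shorten the rows alone. The
  -- column `zero` contributes nothing: `suc u < zero` is decided negatively by computation, so
  -- `filter` drops that pair.
  count-edges-suc : ∀ us vs →
    count (isEdge? G) (cartesianProduct (map suc us) (zero ∷ map suc vs))
      ≡ count (isEdge? G′) (cartesianProduct us vs)
  count-edges-suc []       vs = refl
  count-edges-suc (u ∷ us) vs = begin
    count (isEdge? G) (map (suc u ,_) (map suc vs) ++ rest)
      ≡⟨ count-++ (isEdge? G) (map (suc u ,_) (map suc vs)) rest ⟩
    count (isEdge? G) (map (suc u ,_) (map suc vs)) + count (isEdge? G) rest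
      ≡⟨ cong₂ _+_ row (count-edges-suc us vs) ⟩
    count (isEdge? G′) (map (u ,_) vs) + count (isEdge? G′) (cartesianProduct us vs)
      ≡⟨ count-++ (isEdge? G′) (map (u ,_) vs) _ ⟨
    count (isEdge? G′) (cartesianProduct (u ∷ us) vs) ∎
    where
    open ≡-Reasoning
    rest = cartesianProduct (map suc us) (zero ∷ map suc vs)

    suc-edge : ∀ v → IsEdge G (suc u , suc v) ⇔ IsEdge G′ (u , v)
    suc-edge v = mk⇔ (λ { (s≤s u<v , e) → u<v , e }) (λ (u<v , e) → s≤s u<v , e)

    row : count (isEdge? G) (map (suc u ,_) (map suc vs)) ≡ count (isEdge? G′) (map (u ,_) vs)
    row = begin
      count (isEdge? G) (map (suc u ,_) (map suc vs))
        ≡⟨ count-map (isEdge? G) (λ v → isEdge? G (suc u , v)) (suc u ,_)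
             (λ _ → mk⇔ (λ e → e) (λ e → e)) (map suc vs) ⟩
      count (λ v → isEdge? G (suc u , v)) (map suc vs)
        ≡⟨ count-map (λ v → isEdge? G (suc u , v)) (λ v → isEdge? G′ (u , v)) suc suc-edge vs ⟩
      count (λ v → isEdge? G′ (u , v)) vs
        ≡⟨ count-map (isEdge? G′) (λ v → isEdge? G′ (u , v)) (u ,_)
             (λ _ → mk⇔ (λ e → e) (λ e → e)) vs ⟨
      count (isEdge? G′) (map (u ,_) vs) ∎

  -- Edges are sorted by their smaller endpoint: either it is `zero`, or the edge survives deleting
  -- `zero`.
  length-edges-suc :
    length (edges G) ≡ count (λ v → adj? G zero (suc v)) (allFin n) + length (edges G′)
  length-edges-suc = begin
    length (edges G)
      ≡⟨ cong (λ vs → count (isEdge? G) (cartesianProduct vs vs)) (allFin-suc n) ⟩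
    count (isEdge? G) (map (zero ,_) (map suc (allFin n)) ++ rest)
      ≡⟨ count-++ (isEdge? G) (map (zero ,_) (map suc (allFin n))) rest ⟩
    count (isEdge? G) (map (zero ,_) (map suc (allFin n))) + count (isEdge? G) rest
      ≡⟨ cong₂ _+_ row (count-edges-suc (allFin n) (allFin n)) ⟩
    count (λ v → adj? G zero (suc v)) (allFin n) + length (edges G′) ∎
    where
    open ≡-Reasoning
    rest = cartesianProduct (map suc (allFin n)) (zero ∷ map suc (allFin n))

    row : count (isEdge? G) (map (zero ,_) (map suc (allFin n)))
            ≡ count (λ v → adj? G zero (suc v)) (allFin n)
    row = trans
      (count-map (isEdge? G) (λ v → isEdge? G (zero , v)) (zero ,_)
        (λ _ → mk⇔ (λ e → e) (λ e → e)) (map suc (allFin n)))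
      (count-map (λ v → isEdge? G (zero , v)) (λ v → adj? G zero (suc v)) suc
        (λ _ → mk⇔ proj₂ (s≤s z≤n ,_)) (allFin n))

-- Blow-ups

blowup : Graph k → (vs : List (Fin k)) → Graph (length vs)
blowup G vs = pullback G (lookup vs)

module _ (G : Graph k) where

  adjacentPairs : List (Fin k) → ℕ
  adjacentPairs []       = 0
  adjacentPairs (v ∷ vs) = count (adj? G v) vs + adjacentPairs vs

  length-edges-blowup : ∀ vs → length (edges (blowup G vs)) ≡ adjacentPairs vs
  length-edges-blowup []       = refl
  length-edges-blowup (v ∷ vs) = trans (length-edges-suc (blowup G (v ∷ vs)))
    (cong₂ _+_ degree (length-edges-blowup vs))
    where
    open ≡-Reasoning
    degree : count (adj? G v ∘ lookup vs) (allFin (length vs)) ≡ count (adj? G v) vs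
    degree = begin
      count (adj? G v ∘ lookup vs) (allFin (length vs))
        ≡⟨ count-map (adj? G v) (adj? G v ∘ lookup vs) (lookup vs)
             (λ _ → mk⇔ (λ e → e) (λ e → e)) (allFin (length vs)) ⟨
      count (adj? G v) (map (lookup vs) (allFin (length vs)))
        ≡⟨ cong (count (adj? G v)) (trans (map-tabulate (λ i → i) (lookup vs)) (tabulate-lookup vs)) ⟩
      count (adj? G v) vs ∎

  -- Copies of `v` are not adjacent to one another, so each of them sees only the neighbours of `v`
  -- in `vs`.
  adjacentPairs-replicate : ∀ r v vs →
    adjacentPairs (replicate r v ++ vs) ≡ r * count (adj? G v) vs + adjacentPairs vs
  adjacentPairs-replicate zero    v vs = refl
  adjacentPairs-replicate (suc r) v vs = begin
    count (adj? G v) (replicate r v ++ vs) + adjacentPairs (replicate r v ++ vs)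
      ≡⟨ cong₂ _+_ twins (adjacentPairs-replicate r v vs) ⟩
    count (adj? G v) vs + (r * count (adj? G v) vs + adjacentPairs vs)
      ≡⟨ +-assoc (count (adj? G v) vs) _ _ ⟨
    suc r * count (adj? G v) vs + adjacentPairs vs ∎
    where
    open ≡-Reasoning
    twins : count (adj? G v) (replicate r v ++ vs) ≡ count (adj? G v) vs
    twins = trans (count-++ (adj? G v) (replicate r v) vs)
      (cong (_+ count (adj? G v) vs)
        (count-none (adj? G v) (replicate⁺ r (Graph.irrefl G refl))))

module _ (G : Graph k) (vs : List (Fin k))
         (occurs : ∀ v → v ∈ vs) (neighbour : ∀ v → ∃ (Adj G v)) where

  private
    H : Graph (length vs)
    H = blowup G vs

  walk-project : ∀ {j u v} → Walk H j u v → Walk G j (lookup vs u) (lookup vs v)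
  walk-project []       = []
  walk-project (e ∷ es) = e ∷ walk-project es

  -- The endpoints are prescribed and every inner vertex is replaced by some copy of it. Positive
  -- length is essential: a trivial walk does not lift to a walk between two distinct twins.
  walk-lift : ∀ {j u v} → Walk G (suc j) (lookup vs u) (lookup vs v) → Walk H (suc j) u v
  walk-lift (e ∷ []) = e ∷ []
  walk-lift {u = u} {v} (_∷_ {v = w} e es@(_ ∷ _)) =
    subst (Adj G (lookup vs u)) w≡ e
      ∷ walk-lift (subst (λ t → Walk G _ t (lookup vs v)) w≡ es)
    where
    w≡ : w ≡ lookup vs (index (occurs w))
    w≡ = lookup-index (occurs w)

  -- Distinct twins are at distance 2, so only distances above 2 are preserved
  -- in both directions.
  distance-blowup : ∀ {u v} → Distance H (3 + m) u v ⇔ Distance G (3 + m) (lookup vs u) (lookup vs v)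
  distance-blowup {m} {u} {v} = mk⇔
    (λ (p , shortest) → walk-project p , no-shorter shortest)
    (λ (p , shortest) → walk-lift p , λ j<3+m → shortest j<3+m ∘ walk-project)
    where
    no-shorter : (∀ {j} → j ℕ.< 3 + m → ¬ Walk H j u v) →
                 ∀ {j} → j ℕ.< 3 + m → ¬ Walk G j (lookup vs u) (lookup vs v)
    no-shorter shortest {suc j} j<3+m p = shortest j<3+m (walk-lift p)
    -- Here `u` and `v` are copies of one vertex. Going to a neighbour and back gives a walk of
    -- length 2, which lifts and is still shorter than `3 + m`.
    no-shorter shortest {zero}  _     p = shortest (s≤s (s≤s (s≤s z≤n))) (walk-lift (back-and-forth p))
      where
      back-and-forth : ∀ {a b} → Walk G 0 a b → Walk G 2 a b
      back-and-forth {a} [] with w , e ← neighbour a = e ∷ Graph.sym G e ∷ []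

  length-edges-distance-blowup :
    length (edges (distanceGraph (3 + m) H)) ≡ adjacentPairs (distanceGraph (3 + m) G) vs
  length-edges-distance-blowup {m} = trans
    -- The distance graph of the blow-up and the blow-up of the distance graph share their vertex
    -- set and have equivalent adjacency, hence the same edge list.
    (cong length (filter-≐ (isEdge? (distanceGraph (3 + m) H))
      (isEdge? (blowup (distanceGraph (3 + m) G) vs))
      ( (λ (u<v , d) → u<v , Equivalence.to distance-blowup d)
      , (λ (u<v , d) → u<v , Equivalence.from distance-blowup d))
      (cartesianProduct (allFin _) (allFin _))))
    (length-edges-blowup (distanceGraph (3 + m) G) vs)

  triangleFree-blowup : TriangleFree (distanceGraph (3 + m) G) → TriangleFree (distanceGraph (3 + m) H)
  triangleFree-blowup free u v w uv vw uw =
    free _ _ _ (to uv) (to vw) (to uw)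
    where to = λ {u v} → Equivalence.to (distance-blowup {u = u} {v})

-- The spider

-- A root is encoded as its own parent; `u ≢ v` removes the resulting loop.
fromParents : (Fin k → Fin k) → Graph k
fromParents parent = record
  { Adj    = λ u v → u ≢ v × (parent u ≡ v ⊎ parent v ≡ u)
  ; sym    = λ (u≢v , p) → u≢v ∘ sym , swap p
  ; irrefl = λ u≡v (u≢v , _) → u≢v u≡v
  ; adj?   = λ u v → ¬? (u ≟ v) ×-dec (parent u ≟ v ⊎-dec parent v ≟ u)
  }

pattern center = 0F
pattern arm₁   = 1F
pattern tip₁   = 2F
pattern arm₂   = 3F
pattern tip₂   = 4F
pattern leaf   = 5F

spider : Graph 6
spider = fromParents λ
  { tip₁ → arm₁
  ; tip₂ → arm₂
  ; _    → center
  }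

spider₃ : Graph 6
spider₃ = distanceGraph 3 spider

spider-neighbour : ∀ v → ∃ (Adj spider v)
spider-neighbour = from-yes (all? λ v → any? λ w → adj? spider v w)

spider₃-triangleFree : TriangleFree spider₃
spider₃-triangleFree = from-yes (all? λ u → all? λ v → all? λ w →
  adj? spider₃ u v →-dec adj? spider₃ v w →-dec ¬? (adj? spider₃ u w))

center-isolated : ∀ v → ¬ Adj spider₃ center v
center-isolated = from-yes (all? λ v → ¬? (adj? spider₃ center v))

only-center-isolated : ∀ v → v ≡ center ⊎ ∃ (Adj spider₃ v)
only-center-isolated = from-yes (all? λ v → v ≟ center ⊎-dec any? (adj? spider₃ v))

module _ (p q : ℕ) where

  limbs : List (Fin 6)
  limbs = arm₁ ∷ tip₁ ∷ arm₂ ∷ tip₂ ∷ leaf ∷ []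

  nonCentral : List (Fin 6)
  nonCentral = replicate p leaf ++ replicate q tip₂ ++ limbs

  -- `center` stands first and only once, so its sole copy is `zero`; `limbs` guarantees a copy of
  -- every other vertex.
  blownUp : List (Fin 6)
  blownUp = center ∷ nonCentral

  length-blownUp : length blownUp ≡ 6 + (p + q)
  length-blownUp = cong suc (begin
    length (replicate p leaf ++ replicate q tip₂ ++ limbs)
      ≡⟨ length-++ (replicate p leaf) ⟩
    length (replicate p leaf) + length (replicate q tip₂ ++ limbs)
      ≡⟨ cong₂ _+_ (length-replicate p)
           (trans (length-++ (replicate q tip₂)) (cong (_+ 5) (length-replicate q))) ⟩
    p + (q + 5)
      ≡⟨ +-assoc p q 5 ⟨
    p + q + 5
      ≡⟨ +-comm (p + q) 5 ⟩
    5 + (p + q) ∎)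
    where open ≡-Reasoning

  blownUp-occurs : ∀ v → v ∈ blownUp
  blownUp-occurs zero    = here refl
  blownUp-occurs (suc i) = there (∈-++⁺ʳ (replicate p leaf) (∈-++⁺ʳ (replicate q tip₂) (in-limbs i)))
    where
    in-limbs : ∀ i → suc i ∈ limbs
    in-limbs 0F = here refl
    in-limbs 1F = there (here refl)
    in-limbs 2F = there (there (here refl))
    in-limbs 3F = there (there (there (here refl)))
    in-limbs 4F = there (there (there (there (here refl))))

  nonCentral-≢ : All (_≢ center) nonCentral
  nonCentral-≢ = ++⁺ (replicate⁺ p λ ()) (++⁺ (replicate⁺ q λ ())
    ((λ ()) ∷ (λ ()) ∷ (λ ()) ∷ (λ ()) ∷ (λ ()) ∷ []))

  lookup-center : ∀ u → lookup blownUp u ≡ center → u ≡ zero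
  lookup-center zero    _  = refl
  lookup-center (suc u) eq = contradiction eq (All.lookup nonCentral-≢ (∈-lookup u))

  adjacentPairs-blownUp : adjacentPairs spider₃ blownUp ≡ (2 + p) * (2 + q)
  adjacentPairs-blownUp = begin
    count (adj? spider₃ center) nonCentral + adjacentPairs spider₃ nonCentral
      ≡⟨ cong₂ _+_ (count-none (adj? spider₃ center) {nonCentral} (All.universal center-isolated _))
           (adjacentPairs-replicate spider₃ p leaf _) ⟩
    p * count (adj? spider₃ leaf) (replicate q tip₂ ++ limbs)
      + adjacentPairs spider₃ (replicate q tip₂ ++ limbs)
      ≡⟨ cong₂ (λ d e → p * d + e) leaf-degree (adjacentPairs-replicate spider₃ q tip₂ limbs) ⟩
    -- In `limbs`, `leaf` is adjacent to `tip₁` and `tip₂`, and `tip₂` is adjacent to `leaf` and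
    -- `arm₁`; the 4 counts the edges of the path itself.
    p * (q + 2) + (q * 2 + 4)
      ≡⟨ arithmetic p q ⟩
    (2 + p) * (2 + q) ∎
    where
    open ≡-Reasoning
    leaf-degree : count (adj? spider₃ leaf) (replicate q tip₂ ++ limbs) ≡ q + 2
    leaf-degree = trans (count-++ (adj? spider₃ leaf) (replicate q tip₂) limbs)
      (cong (_+ 2) (count-replicate (adj? spider₃ leaf) (from-yes (adj? spider₃ leaf tip₂)) q))

    arithmetic : ∀ p q → p * (q + 2) + (q * 2 + 4) ≡ (2 + p) * (2 + q)
    arithmetic = solve-∀

  blownUpSpider : Graph (length blownUp)
  blownUpSpider = blowup spider blownUp

  -- A copy of any vertex other than `center` has a neighbour: its original has some neighbour `w`
  -- in `spider₃`, and any copy of `w` serves.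
  isolated-unique : ∀ u → (∀ v → ¬ Distance blownUpSpider 3 u v) → u ≡ zero
  isolated-unique u isolated =
    [ lookup-center u
    , (λ (w , d) → contradiction
        (Equivalence.from (distance-blowup spider blownUp blownUp-occurs spider-neighbour)
          (subst (Distance spider 3 (lookup blownUp u)) (lookup-index (blownUp-occurs w)) d))
        (isolated (index (blownUp-occurs w))))
    ]′ (only-center-isolated (lookup blownUp u))

-- The double broom

module _ (a b : ℕ) where

  private
    D : Graph (2 + (a + b))
    D = doubleBroom a b

  -- Every vertex is within distance 2 of `x`: its own leaves and `y` at distance 1, the leaves of
  -- `y` through `y`.
  broom-x-isolated : ∀ v → ¬ Distance D 3 0F v
  broom-x-isolated 0F (_ , shortest) = shortest (s≤s z≤n) []
  broom-x-isolated 1F (_ , shortest) = shortest (s≤s (s≤s z≤n)) (_ ∷ [])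
  broom-x-isolated (suc (suc i)) (_ , shortest) with splitAt a i in eq
  ... | inj₁ _ = shortest (s≤s (s≤s z≤n)) (edge ∷ [])
    where
    edge : Adj D 0F (suc (suc i))
    edge rewrite eq = _
  ... | inj₂ _ = shortest (s≤s (s≤s (s≤s z≤n))) (_∷_ {v = 1F} _ (edge ∷ []))
    where
    edge : Adj D 1F (suc (suc i))
    edge rewrite eq = _

  broom-y-isolated : ∀ v → ¬ Distance D 3 1F v
  broom-y-isolated 0F (_ , shortest) = shortest (s≤s (s≤s z≤n)) (_ ∷ [])
  broom-y-isolated 1F (_ , shortest) = shortest (s≤s z≤n) []
  broom-y-isolated (suc (suc i)) (_ , shortest) with splitAt a i in eq
  ... | inj₁ _ = shortest (s≤s (s≤s (s≤s z≤n))) (_∷_ {v = 0F} _ (edge ∷ []))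
    where
    edge : Adj D 0F (suc (suc i))
    edge rewrite eq = _
  ... | inj₂ _ = shortest (s≤s (s≤s z≤n)) (edge ∷ [])
    where
    edge : Adj D 1F (suc (suc i))
    edge rewrite eq = _

isolated-reflects-≅ : {G : Graph m} {H : Graph n} (G≅H : G ≅ H) → ∀ w →
  (∀ v → ¬ Adj H w v) → ∀ v → ¬ Adj G (Inverse.from (_≅_.vertices G≅H) w) v
isolated-reflects-≅ {H = H} G≅H w isolated v e =
  isolated (to v) (subst (λ u → Adj H u (to v)) (strictlyInverseˡ w) (Equivalence.to (adjacent _ v) e))
  where
  open _≅_ G≅H
  open Inverse vertices

-- The inverse isomorphism would send both centres of the broom to the unique isolated vertex
-- `zero`, contradicting injectivity.
blownUpSpider-≇-broom : ∀ p q a b →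
  ¬ (distanceGraph 3 (blownUpSpider p q) ≅ distanceGraph 3 (doubleBroom a b))
blownUpSpider-≇-broom p q a b iso = 0≢1 (begin
  0F           ≡⟨ strictlyInverseˡ 0F ⟨
  to (from 0F) ≡⟨ cong to (trans (from≡zero (broom-x-isolated a b)) (sym (from≡zero (broom-y-isolated a b)))) ⟩
  to (from 1F) ≡⟨ strictlyInverseˡ 1F ⟩
  1F           ∎)
  where
  open ≡-Reasoning
  open Inverse (_≅_.vertices iso)

  from≡zero : ∀ {w} → (∀ v → ¬ Distance (doubleBroom a b) 3 w v) → from w ≡ zero
  from≡zero {w} isolated = isolated-unique p q (from w) (isolated-reflects-≅ iso w isolated)

  0≢1 : _≢_ {A = Fin (2 + (a + b))} 0F 1F
  0≢1 ()

-- Products of balanced halves as quarter squares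

⌊n/2⌋*⌈n/2⌉≡n²/4 : ∀ n → ⌊ n /2⌋ * ⌈ n /2⌉ ≡ n ^ 2 / 4
⌊n/2⌋*⌈n/2⌉≡n²/4 0             = refl
⌊n/2⌋*⌈n/2⌉≡n²/4 1             = refl
⌊n/2⌋*⌈n/2⌉≡n²/4 (suc (suc n)) = begin
  (1 + ⌊ n /2⌋) * (1 + ⌈ n /2⌉)
    ≡⟨ expand ⌊ n /2⌋ ⌈ n /2⌉ ⟩
  1 + (⌊ n /2⌋ + ⌈ n /2⌉) + ⌊ n /2⌋ * ⌈ n /2⌉
    -- Both sides grow by `1 + n` when `n` grows by two, as the square grows by `(1 + n) * 4`; this
    -- multiple of 4 splits off exactly from the rounded quotient.
    ≡⟨ cong₂ (λ s t → 1 + s + t) (⌊n/2⌋+⌈n/2⌉≡n n) (⌊n/2⌋*⌈n/2⌉≡n²/4 n) ⟩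
  (1 + n) + n ^ 2 / 4
    ≡⟨ cong (_+ n ^ 2 / 4) (m*n/n≡m (1 + n) 4) ⟨
  (1 + n) * 4 / 4 + n ^ 2 / 4
    ≡⟨ +-distrib-/-∣ˡ (n ^ 2) (n∣m*n (1 + n)) ⟨
  ((1 + n) * 4 + n ^ 2) / 4
    ≡⟨ /-congˡ {o = 4} (square n) ⟨
  (2 + n) ^ 2 / 4 ∎
  where
  open ≡-Reasoning
  expand : ∀ s t → (1 + s) * (1 + t) ≡ 1 + (s + t) + s * t
  expand = solve-∀

  square : ∀ n → (2 + n) * ((2 + n) * 1) ≡ (1 + n) * 4 + n * (n * 1)
  square = solve-∀

-- Choice of the blow-up and transport to order `n`

mainTheorem3 : (n : ℕ) → 9 ≤ n →
    Σ[ H ∈ Graph n ]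
    ( TriangleFree (distanceGraph 3 H)
    × length (edges (distanceGraph 3 H)) ≡ ((n ∸ 2) ^ 2) / 4
    × ¬ (distanceGraph 3 H ≅ distanceGraph 3 (balancedDoubleBroom n)) )
-- The graph has order `length (blownUp p q)`, equal to `n` only propositionally, so all claims are
-- transported together.
mainTheorem3 n 9≤n = subst Good order
  ( blownUpSpider p q
  , triangleFree-blowup spider (blownUp p q) (blownUp-occurs p q) spider-neighbour spider₃-triangleFree
  , edge-count
  , blownUpSpider-≇-broom p q _ _ )
  where
  open ≡-Reasoning

  Good : ℕ → Set₁
  Good n = Σ[ H ∈ Graph n ]
    ( TriangleFree (distanceGraph 3 H)
    × length (edges (distanceGraph 3 H)) ≡ ((n ∸ 2) ^ 2) / 4
    × ¬ (distanceGraph 3 H ≅ distanceGraph 3 (balancedDoubleBroom n)) )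

  -- The `r` vertices beyond the six of the spider are split evenly, which balances the factors
  -- `2 + p` and `2 + q`.
  r = n ∸ 6
  p = ⌊ r /2⌋
  q = ⌈ r /2⌉

  length≡6+r : length (blownUp p q) ≡ 6 + r
  length≡6+r = trans (length-blownUp p q) (cong (6 +_) (⌊n/2⌋+⌈n/2⌉≡n r))

  order : length (blownUp p q) ≡ n
  order = trans length≡6+r (m+[n∸m]≡n (≤-trans (m≤m+n 6 3) 9≤n))

  edge-count : length (edges (distanceGraph 3 (blownUpSpider p q)))
                 ≡ (length (blownUp p q) ∸ 2) ^ 2 / 4
  edge-count = begin
    length (edges (distanceGraph 3 (blownUpSpider p q)))
      ≡⟨ length-edges-distance-blowup spider (blownUp p q) (blownUp-occurs p q) spider-neighbour ⟩
    adjacentPairs spider₃ (blownUp p q)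
      ≡⟨ adjacentPairs-blownUp p q ⟩
    (2 + p) * (2 + q)
      -- By computation, `2 + p` and `2 + q` are the two halves of `4 + r`, which is `n ∸ 2`.
      ≡⟨ ⌊n/2⌋*⌈n/2⌉≡n²/4 (4 + r) ⟩
    (4 + r) ^ 2 / 4
      ≡⟨ cong (λ l → (l ∸ 2) ^ 2 / 4) length≡6+r ⟨
    (length (blownUp p q) ∸ 2) ^ 2 / 4 ∎
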